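{- For every integer $n\geq 1$, $$A_{N\geq O}(n)-B_{N\geq O}(n)\equiv 0 \pmod 2,$$ and $$A_{N\geq O}(n)-B_{N\geq O}(n)\geq 0,\quad\text{with strict inequality if } n\geq 3.$$
   Context: A partition of $n$ is a finite non-increasing sequence of positive integers (its parts) with sum $n$. An overpartition of $n$ is a partition of $n$ in which the first occurrence of each number may be overlined (so for each size $t$ at most one part of size $t$ is overlined); the size of a part $t$ or $\overline{t}$ is $t$, and the weight is the sum of sizes. For an overpartition $\pi$, let $SO(\pi)$ be the size of the smallest overlined part of $\pi$ if $\pi$ has overlined parts, and $SO(\pi)=0$ otherwise. Let $\ell_{N\geq O}(\pi)$ be the number of non-overlined parts of $\pi$ (counted with multiplicity) of size greater than or equal to $SO(\pi)$. $A_{N\geq O}(n)$ (resp. $B_{N\geq O}(n)$) is the number of overpartitions $\pi$ of $n$ with $\ell_{N\geq O}(\pi)$ even (resp. odd). -}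

module Defs where

open import Data.Bool using (Bool; true; false; not)
import Data.Bool.Properties as Bool
open import Data.Empty using (⊥)
open import Data.List using (List; []; _∷_; length; map; filter; filterᵇ; foldr; upTo; cartesianProductWith)
open import Data.List.Membership.Propositional using (_∈_)
open import Data.List.Membership.Propositional.Properties
  using (∈-cartesianProductWith⁺; ∈-cartesianProductWith⁻; ∈-upTo⁺; ∈-filter⁺; ∈-filter⁻)
open import Data.List.Relation.Unary.All as All using (All; []; _∷_; all?)
open import Data.List.Relation.Unary.AllPairs using (AllPairs; []; _∷_; allPairs?)
open import Data.List.Relation.Unary.Any using (here; there)
open import Data.List.Relation.Unary.Linked using (Linked; linked?)
open import Data.List.Relation.Unary.Unique.Propositional using (Unique)
import Data.List.Relation.Unary.Unique.Propositional.Properties as Unique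
open import Data.Nat using (ℕ; zero; suc; _⊓_; _≤_; _<_; _≥_; _≤?_; _<?_; _≥?_; _≟_; z≤n; s≤s; parity)
open import Data.Nat.ListAction using (sum)
open import Data.Nat.Properties using (+-mono-≤; ≤-trans; m≤m+n; m≤n+m)
open import Data.Parity using (0ℙ; 1ℙ)
import Data.Parity.Properties as Parity
open import Data.Product using (_×_; _,_; proj₂)
open import Function using (_∘_; _⇔_; mk⇔)
open import Relation.Binary.PropositionalEquality using (_≡_; refl)
open import Relation.Nullary using (Dec)
open import Relation.Nullary.Decidable using (map′; _×-dec_; _→-dec_)

record Part : Set where
  constructor part
  field
    size      : ℕ
    overlined : Bool

open Part public

weight : List Part → ℕ
weight = sum ∘ map size

record IsOverpartition (n : ℕ) (π : List Part) : Set where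
  constructor isOverpartition
  field
    positive      : All (λ p → 0 < size p) π
    nonIncreasing : Linked _≥_ (map size π)
    -- A part with an earlier part of the same size is not a first occurrence,
    -- hence is not overlined.
    onlyFirst     : AllPairs (λ p q → size p ≡ size q → overlined q ≡ false) π
    weight≡n      : weight π ≡ n

isOverpartition? : ∀ n π → Dec (IsOverpartition n π)
isOverpartition? n π =
  map′ (λ (a , b , c , d) → isOverpartition a b c d)
       (λ (isOverpartition a b c d) → a , b , c , d)
       (all? (λ p → 0 <? size p) π
        ×-dec linked? _≥?_ (map size π)
        ×-dec allPairs? (λ p q → (size p ≟ size q) →-dec (overlined q Bool.≟ false)) π
        ×-dec (weight π ≟ n))

-- All lists of length at most k with entries in xs.
words : {A : Set} → List A → ℕ → List (List A)
words xs zero    = [] ∷ []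
words xs (suc k) = [] ∷ cartesianProductWith _∷_ xs (words xs k)

-- All parts of size at most n (including the size 0, which is not admissible).
partsUpTo : ℕ → List Part
partsUpTo n = cartesianProductWith part (upTo (suc n)) (false ∷ true ∷ [])

-- Every overpartition of n has at most n parts, each of size at most n; that this
-- list contains each overpartition of n exactly once is shown by
-- ∈-overpartitions and overpartitions-unique.
overpartitions : ℕ → List (List Part)
overpartitions n = filter (isOverpartition? n) (words (partsUpTo n) n)

minimum₀ : List ℕ → ℕ
minimum₀ []       = 0
minimum₀ (x ∷ xs) = foldr _⊓_ x xs

SO : List Part → ℕ
SO π = minimum₀ (map size (filterᵇ overlined π))

ℓN≥O : List Part → ℕ
ℓN≥O π = length (filter (λ p → SO π ≤? size p) (filterᵇ (not ∘ overlined) π))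

-- 0ℙ is the even parity, 1ℙ the odd one.
AN≥O BN≥O : ℕ → ℕ
AN≥O n = length (filter (λ π → parity (ℓN≥O π) Parity.≟ 0ℙ) (overpartitions n))
BN≥O n = length (filter (λ π → parity (ℓN≥O π) Parity.≟ 1ℙ) (overpartitions n))

private
  ∈-words : ∀ {A : Set} {xs ys : List A} {k} → All (_∈ xs) ys → length ys ≤ k → ys ∈ words xs k
  ∈-words {k = zero}  []       _       = here refl
  ∈-words {k = suc k} []       _       = here refl
  ∈-words {k = suc k} (a ∷ as) (s≤s l) = there (∈-cartesianProductWith⁺ _∷_ a (∈-words as l))

  words-unique : ∀ {A : Set} {xs : List A} → Unique xs → ∀ k → Unique (words xs k)
  words-unique u zero    = [] ∷ []
  words-unique {xs = xs} u (suc k) =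
    All.tabulate (λ { y∈ refl → nil∉ y∈ })
    ∷ Unique.cartesianProductWith⁺ _∷_ (λ { refl → refl , refl }) u (words-unique u k)
    where
    nil∉ : [] ∈ cartesianProductWith _∷_ xs (words xs k) → ⊥
    nil∉ m with ∈-cartesianProductWith⁻ _∷_ xs (words xs k) m
    ... | _ , _ , _ , _ , ()

  partsUpTo-unique : ∀ n → Unique (partsUpTo n)
  partsUpTo-unique n =
    Unique.cartesianProductWith⁺ part (λ { refl → refl , refl }) (Unique.upTo⁺ (suc n))
      (((λ ()) ∷ []) ∷ [] ∷ [])

  ∈-partsUpTo : ∀ {n} p → size p ≤ n → p ∈ partsUpTo n
  ∈-partsUpTo (part s b) s≤n = ∈-cartesianProductWith⁺ part (∈-upTo⁺ (s≤s s≤n)) (∈-bools b)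
    where
    ∈-bools : ∀ b → b ∈ (false ∷ true ∷ [])
    ∈-bools false = here refl
    ∈-bools true  = there (here refl)

  length≤weight : ∀ {π} → All (λ p → 0 < size p) π → length π ≤ weight π
  length≤weight []       = z≤n
  length≤weight (p ∷ ps) = +-mono-≤ p (length≤weight ps)

  sizes≤weight : ∀ π → All (λ p → size p ≤ weight π) π
  sizes≤weight []      = []
  sizes≤weight (p ∷ π) =
    m≤m+n (size p) (weight π)
    ∷ All.map (λ le → ≤-trans le (m≤n+m (weight π) (size p))) (sizes≤weight π)

∈-overpartitions : ∀ n π → π ∈ overpartitions n ⇔ IsOverpartition n π
∈-overpartitions n π = mk⇔ (proj₂ ∘ ∈-filter⁻ (isOverpartition? n) {xs = words (partsUpTo n) n}) complete
  where
  complete : IsOverpartition n π → π ∈ overpartitions n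
  complete h@(isOverpartition pos _ _ refl) =
    ∈-filter⁺ (isOverpartition? n)
      (∈-words (All.map (λ {p} → ∈-partsUpTo p) (sizes≤weight π)) (length≤weight pos)) h

overpartitions-unique : ∀ n → Unique (overpartitions n)
overpartitions-unique n =
  Unique.filter⁺ (isOverpartition? n) (words-unique (partsUpTo-unique n) n)

{-# OPTIONS --safe #-}
-- Let T toggle the overline of the first (largest) part; it is an involution without
-- fixed points on the overpartitions of n ≥ 1, so A + B is even.  If the other parts
-- include an overlined one, T changes ℓ by one.  Otherwise the two values of ℓ are
-- k − 1 and the number of parts, where k is the multiplicity of the largest part m.
-- If both are odd, then k ≥ 2 and there are at least three parts m, m, c, …;
-- replacing these three by m + c, m makes both values even, and c is recovered as the
-- difference of the two largest parts.  So T, or this merging where T fails, injects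
-- the odd overpartitions into the even ones.  For n ≥ 3 it misses (n − 1) + 1.

module Submission where

open import Defs
open import Data.Integer using (+_; _-_; _≤_; _<_)
open import Data.Integer.Divisibility using (_∣_)
open import Data.Nat as ℕ using (ℕ)
open import Data.Product using (_×_)

open import Data.Bool using (Bool; true; false; not)
import Data.Bool.Properties as Bool
import Data.Integer as ℤ
import Data.Integer.Properties as ℤ
open import Data.List using (List; []; _∷_; _++_; foldr; length; map; filter; filterᵇ)
open import Data.List.Membership.Propositional using (_∈_)
open import Data.List.Membership.Propositional.Properties
  using (∈-∃++; ∈-++⁺ˡ; ∈-++⁺ʳ; ∈-++⁻; ∈-map⁻; ∈-filter⁺; ∈-filter⁻)
open import Data.List.Properties using (length-++; length-map; filter-all; filter-none; filter-accept)
open import Data.List.Relation.Binary.Subset.Propositional using (_⊆_)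
open import Data.List.Relation.Unary.All as All using (All; []; _∷_)
open import Data.List.Relation.Unary.AllPairs using ([]; _∷_)
open import Data.List.Relation.Unary.Any using (here; there)
open import Data.List.Relation.Unary.Linked using (Linked; []; [-]; _∷_)
open import Data.List.Relation.Unary.Unique.Propositional using (Unique)
import Data.List.Relation.Unary.Unique.Propositional.Properties as Unique
open import Data.Nat using (zero; suc; _⊓_; _≥_; parity; z≤n; s≤s; z<s)
import Data.Nat.Divisibility as ℕ∣
import Data.Nat.Properties as ℕ
open import Data.Nat.Tactic.RingSolver using (solve-∀)
open import Data.Parity using (0ℙ; 1ℙ; _⁻¹)
import Data.Parity.Properties as Parity
open import Data.Product using (_,_; proj₁; proj₂)
open import Data.Sum using (inj₁; inj₂)
open import Function using (_∘_; Equivalence)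
open import Relation.Binary.PropositionalEquality
  using (_≡_; _≢_; refl; sym; trans; cong; subst; module ≡-Reasoning)
open import Relation.Nullary using (does; contradiction)
open import Relation.Unary using (Decidable)

private
  variable
    A B : Set
    m n c : ℕ
    b : Bool
    π ρ : List Part

-- Counting by injections between duplicate-free lists

unique-⊆⇒length≤ : {xs ys : List A} → Unique xs → xs ⊆ ys → length xs ℕ.≤ length ys
unique-⊆⇒length≤ []       _  = z≤n
unique-⊆⇒length≤ {xs = x ∷ xs} (x∉ ∷ u) xs⊆
  with h , t , refl ← ∈-∃++ (xs⊆ (here refl)) = begin
    suc (length xs)            ≤⟨ s≤s (unique-⊆⇒length≤ u xs⊆h++t) ⟩
    suc (length (h ++ t))      ≡⟨ cong suc (length-++ h) ⟩
    suc (length h ℕ.+ length t) ≡⟨ ℕ.+-suc (length h) (length t) ⟨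
    length h ℕ.+ suc (length t) ≡⟨ length-++ h ⟨
    length (h ++ x ∷ t)        ∎
  where
  open ℕ.≤-Reasoning
  -- One occurrence of `x` may be deleted from `ys`, because `x` does not recur in the tail `xs`.
  xs⊆h++t : xs ⊆ h ++ t
  xs⊆h++t y∈ with ∈-++⁻ h (xs⊆ (there y∈))
  ... | inj₁ y∈h          = ∈-++⁺ˡ y∈h
  ... | inj₂ (here refl)  = contradiction refl (All.lookup x∉ y∈)
  ... | inj₂ (there y∈t)  = ∈-++⁺ʳ h y∈t

-- Restricted to a list, since the map of interest is shown injective on odd overpartitions only.
InjectiveOn : List A → (A → B) → Set
InjectiveOn xs f = ∀ {x y} → x ∈ xs → y ∈ xs → f x ≡ f y → x ≡ y

module _ {f : A → B} where

  map-unique : ∀ {xs} → InjectiveOn xs f → Unique xs → Unique (map f xs)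
  map-unique inj []       = []
  map-unique {x ∷ xs} inj (x∉ ∷ u) =
    All.tabulate fx≢ ∷ map-unique (λ x∈ y∈ → inj (there x∈) (there y∈)) u
    where
    fx≢ : ∀ {z} → z ∈ map f xs → f x ≢ z
    fx≢ z∈ refl with y , y∈ , eq ← ∈-map⁻ f z∈ =
      All.lookup x∉ y∈ (inj (here refl) (there y∈) eq)

  module _ {xs : List A} {ys : List B} (u : Unique xs)
           (into : ∀ {x} → x ∈ xs → f x ∈ ys) (inj : InjectiveOn xs f) where

    map-⊆ : map f xs ⊆ ys
    map-⊆ z∈ with x , x∈ , refl ← ∈-map⁻ f z∈ = into x∈

    injection⇒length≤ : length xs ℕ.≤ length ys
    injection⇒length≤ = subst (ℕ._≤ length ys) (length-map f xs)
      (unique-⊆⇒length≤ (map-unique inj u) map-⊆)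

    -- Putting the missed value in front of the image gives a longer duplicate-free list that still
    -- lies in `ys`.
    nonsurjective⇒length< : ∀ {y} → y ∈ ys → (∀ {x} → x ∈ xs → f x ≢ y) → length xs ℕ.< length ys
    nonsurjective⇒length< {y} y∈ missed = subst (ℕ._< length ys) (length-map f xs)
      (unique-⊆⇒length≤ (All.tabulate y≢ ∷ map-unique inj u)
        λ { (here refl) → y∈ ; (there z∈) → map-⊆ z∈ })
      where
      y≢ : ∀ {z} → z ∈ map f xs → y ≢ z
      y≢ z∈ refl with x , x∈ , eq ← ∈-map⁻ f z∈ = missed x∈ (sym eq)

length-filter-complement : {P Q : A → Set} (P? : Decidable P) (Q? : Decidable Q) →
  (∀ x → does (Q? x) ≡ not (does (P? x))) → ∀ xs →
  length (filter P? xs) ℕ.+ length (filter Q? xs) ≡ length xs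
length-filter-complement P? Q? compl []       = refl
length-filter-complement P? Q? compl (x ∷ xs)
  with does (P? x) | does (Q? x) | compl x | length-filter-complement P? Q? compl xs
... | true  | false | _ | ih = cong suc ih
... | false | true  | _ | ih = trans (ℕ.+-suc _ _) (cong suc ih)

-- Values of `ℓN≥O` and the effect of the first overline

Plain : List Part → Set
Plain = All (λ p → overlined p ≡ false)

overlined-plain : Plain ρ → filterᵇ overlined ρ ≡ []
overlined-plain []          = refl
overlined-plain (refl ∷ ps) = overlined-plain ps

nonOverlined-plain : Plain ρ → filterᵇ (not ∘ overlined) ρ ≡ ρ
nonOverlined-plain []          = refl
nonOverlined-plain (refl ∷ ps) = cong (_ ∷_) (nonOverlined-plain ps)

-- Without overlined parts `SO` is 0, so every part counts.
ℓ-plain : Plain ρ → ℓN≥O ρ ≡ length ρ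
ℓ-plain {ρ} pl rewrite overlined-plain pl | nonOverlined-plain pl =
  cong length (filter-all (λ p → 0 ℕ.≤? size p) {xs = ρ} (All.tabulate λ _ → z≤n))

ℓ-overlined-head : Plain ρ → ℓN≥O (part m true ∷ ρ) ≡ length (filter (λ p → m ℕ.≤? size p) ρ)
ℓ-overlined-head pl rewrite overlined-plain pl | nonOverlined-plain pl = refl

-- `minimum₀` takes the head of the list as the seed of its fold, so an overlined part put in front
-- displaces the old seed; this exchange restores it.
foldr-⊓-swap : ∀ x y xs → x ⊓ foldr _⊓_ y xs ≡ y ⊓ foldr _⊓_ x xs
foldr-⊓-swap x y []       = ℕ.⊓-comm x y
foldr-⊓-swap x y (z ∷ xs) = begin
  x ⊓ (z ⊓ foldr _⊓_ y xs) ≡⟨ swap x z _ ⟩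
  z ⊓ (x ⊓ foldr _⊓_ y xs) ≡⟨ cong (z ⊓_) (foldr-⊓-swap x y xs) ⟩
  z ⊓ (y ⊓ foldr _⊓_ x xs) ≡⟨ swap z y _ ⟩
  y ⊓ (z ⊓ foldr _⊓_ x xs) ∎
  where
  open ≡-Reasoning
  swap : ∀ x y z → x ⊓ (y ⊓ z) ≡ y ⊓ (x ⊓ z)
  swap x y z = trans (sym (ℕ.⊓-assoc x y z)) (trans (cong (_⊓ z) (ℕ.⊓-comm x y)) (ℕ.⊓-assoc y x z))

foldr-⊓≤ : ∀ x xs → foldr _⊓_ x xs ℕ.≤ x
foldr-⊓≤ x []       = ℕ.≤-refl
foldr-⊓≤ x (y ∷ xs) = ℕ.≤-trans (ℕ.m⊓n≤n y _) (foldr-⊓≤ x xs)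

-- If ρ has an overlined part, SO is not affected by a larger part in front of ρ,
-- whether overlined or not.
ℓ-toggle-head : All (λ p → size p ℕ.≤ m) ρ → ∀ {q qs} → filterᵇ overlined ρ ≡ q ∷ qs →
  ℓN≥O (part m false ∷ ρ) ≡ suc (ℓN≥O (part m true ∷ ρ))
ℓ-toggle-head {m} {ρ} bound {q} {qs} eq rewrite eq =
  trans (cong length (filter-accept (λ p → SO′ ℕ.≤? size p) SO′≤m))
    (cong (λ s → suc (length (filter (λ p → s ℕ.≤? size p) (filterᵇ (not ∘ overlined) ρ)))) (sym SO-eq))
  where
  SO′ = foldr _⊓_ (size q) (map size qs)
  q≤m : size q ℕ.≤ m
  q≤m = All.lookup bound (proj₁ (∈-filter⁻ (λ p → Bool.T? (overlined p)) (subst (q ∈_) (sym eq) (here refl))))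
  SO′≤m : SO′ ℕ.≤ m
  SO′≤m = ℕ.≤-trans (foldr-⊓≤ (size q) (map size qs)) q≤m
  SO-eq : size q ⊓ foldr _⊓_ m (map size qs) ≡ SO′
  SO-eq = trans (foldr-⊓-swap (size q) m (map size qs)) (ℕ.m≥n⇒m⊓n≡n SO′≤m)

all-plain : filterᵇ overlined ρ ≡ [] → Plain ρ
all-plain {[]}                 _  = []
all-plain {part _ false ∷ ρ} eq = refl ∷ all-plain eq

-- Toggling the overline of the first part

Odd Even : List Part → Set
Odd  π = parity (ℓN≥O π) ≡ 1ℙ
Even π = parity (ℓN≥O π) ≡ 0ℙ

toggle : List Part → List Part
toggle []             = []
toggle (part m b ∷ ρ) = part m (not b) ∷ ρ

toggle-involutive : ∀ π → toggle (toggle π) ≡ π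
toggle-involutive []             = refl
toggle-involutive (part m b ∷ ρ) = cong (λ b′ → part m b′ ∷ ρ) (Bool.not-involutive b)

toggle-injective : ∀ {π π′} → toggle π ≡ toggle π′ → π ≡ π′
toggle-injective eq =
  trans (sym (toggle-involutive _)) (trans (cong toggle eq) (toggle-involutive _))

-- `onlyFirst` constrains the overline of the later part of each pair, so that of the first part is
-- free; the other conditions see sizes only.
toggle-overpartition : IsOverpartition n π → IsOverpartition n (toggle π)
toggle-overpartition {π = []}    h = h
toggle-overpartition {π = _ ∷ _} (isOverpartition (p ∷ ps) d (f ∷ fs) w) =
  isOverpartition (p ∷ ps) d (f ∷ fs) w

-- Overpartitions that stay odd under `toggle`

bounded : Linked _≥_ (m ∷ map size ρ) → All (λ p → size p ℕ.≤ m) ρ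
bounded {ρ = []}    _        = []
bounded {ρ = _ ∷ _} (q≤ ∷ l) = q≤ ∷ All.map (λ le → ℕ.≤-trans le q≤) (bounded l)

-- The shape of the overpartitions π for which π and toggle π are both odd.
data Mergeable : List Part → Set where
  mergeable : Plain ρ → parity (length ρ) ≡ 0ℙ →
    Mergeable (part m b ∷ part m false ∷ part c false ∷ ρ)

parity-suc≢ : ∀ n → parity (suc n) ≢ parity n
parity-suc≢ n eq = p⁻¹≢p (parity (suc n)) (trans (Parity.suc-homo-⁻¹ n) (sym eq))
  where
  p⁻¹≢p : ∀ p → p ⁻¹ ≢ p
  p⁻¹≢p 0ℙ ()
  p⁻¹≢p 1ℙ ()

-- An overlined part in `ρ` would make the two values of `ℓN≥O` consecutive, hence of opposite
-- parity.
plain-of-odd : All (λ p → size p ℕ.≤ m) ρ →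
  Odd (part m true ∷ ρ) → Odd (part m false ∷ ρ) → Plain ρ
plain-of-odd {m} {ρ} bound o₁ o₂ = from (filterᵇ overlined ρ) refl
  where
  from : ∀ qs → filterᵇ overlined ρ ≡ qs → Plain ρ
  from []       eq = all-plain eq
  from (q ∷ qs) eq = contradiction
    (trans (cong parity (sym (ℓ-toggle-head bound eq))) (trans o₂ (sym o₁)))
    (parity-suc≢ (ℓN≥O (part m true ∷ ρ)))

-- The odd filtered count is nonzero, so `ρ` contains a part at least `m`; by the ordering its head
-- is exactly `m`. The odd `suc (length ρ)` then forces a further part.
mergeable-plain : Plain ρ → Linked _≥_ (m ∷ map size ρ) →
  parity (length (filter (λ p → m ℕ.≤? size p) ρ)) ≡ 1ℙ → parity (suc (length ρ)) ≡ 1ℙ →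
  ∀ b → Mergeable (part m b ∷ ρ)
mergeable-plain {part k _ ∷ []} _ _ _ ()
mergeable-plain {part k _ ∷ part c _ ∷ ρ} {m} (refl ∷ refl ∷ pl) (k≤m ∷ dec) o₁ o₂ b
  with refl ← ℕ.≤-antisym k≤m (ℕ.≮⇒≥ λ k<m → contradiction
      (trans (sym o₁) (cong (parity ∘ length) (filter-none (λ p → m ℕ.≤? size p)
        (All.map (λ q≤k m≤q → ℕ.<⇒≱ k<m (ℕ.≤-trans m≤q q≤k))
          (ℕ.≤-refl ∷ bounded {ρ = part c false ∷ ρ} dec)))))
      λ ()) =
  -- `parity` cancels two successors by computation, so `o₂` speaks of one more than the length of
  -- what follows `c`.
  mergeable pl (trans (sym (Parity.suc-homo-⁻¹ (length ρ))) (cong _⁻¹ o₂))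

mergeable-of-odd : IsOverpartition n π → 0 ℕ.< n → Odd π → Odd (toggle π) → Mergeable π
mergeable-of-odd {π = []} (isOverpartition _ _ _ refl) () _ _
mergeable-of-odd {π = part m b ∷ ρ} h 0<n o o′ = go b o o′
  where
  dec = IsOverpartition.nonIncreasing h
  both : Odd (part m true ∷ ρ) → Odd (part m false ∷ ρ) → Mergeable (part m b ∷ ρ)
  both o₁ o₂ = mergeable-plain pl dec
    (trans (cong parity (sym (ℓ-overlined-head pl))) o₁)
    (trans (cong parity (sym (ℓ-plain (refl ∷ pl)))) o₂) b
    where pl = plain-of-odd (bounded dec) o₁ o₂
  go : ∀ b′ → Odd (part m b′ ∷ ρ) → Odd (part m (not b′) ∷ ρ) → Mergeable (part m b ∷ ρ)
  go true  o₁ o₂ = both o₁ o₂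
  go false o₂ o₁ = both o₁ o₂

-- Merging the first and third parts

merge : List Part → List Part
merge (part m b ∷ q ∷ part c _ ∷ ρ) = part (m ℕ.+ c) b ∷ q ∷ ρ
merge π                             = π

unmerge : List Part → List Part
unmerge (part h b ∷ q ∷ ρ) = part (size q) b ∷ q ∷ part (h ℕ.∸ size q) false ∷ ρ
unmerge π                  = π

unmerge-merge : Mergeable π → unmerge (merge π) ≡ π
unmerge-merge (mergeable {m = m} {c = c} _ _) rewrite ℕ.m+n∸m≡n m c = refl

merge-injective : ∀ {π π′} → Mergeable π → Mergeable π′ → merge π ≡ merge π′ → π ≡ π′
merge-injective r r′ eq = trans (sym (unmerge-merge r)) (trans (cong unmerge eq) (unmerge-merge r′))

merge-overpartition : Mergeable π → IsOverpartition n π → IsOverpartition n (merge π)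
merge-overpartition (mergeable {ρ = ρ} {m = m} {c = c} pl _)
  (isOverpartition (m>0 ∷ _ ∷ _ ∷ ps) (_ ∷ dec) (_ ∷ (_ ∷ f) ∷ _ ∷ fs) w) =
  isOverpartition (ℕ.≤-trans m>0 (ℕ.m≤m+n m c) ∷ m>0 ∷ ps) (ℕ.m≤m+n m c ∷ skip dec)
    -- Everything behind the merged part is plain, so `onlyFirst` at the new head needs no
    -- comparison of sizes.
    (((λ _ → refl) ∷ All.map (λ pl _ → pl) pl) ∷ f ∷ fs)
    (trans (rearrange m c (weight ρ)) w)
  where
  skip : ∀ {ρ} → Linked _≥_ (m ∷ c ∷ map size ρ) → Linked _≥_ (m ∷ map size ρ)
  skip {[]}    _               = [-]
  skip {_ ∷ _} (c≤ ∷ q≤ ∷ dec) = ℕ.≤-trans q≤ c≤ ∷ dec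
  rearrange : ∀ m c w → m ℕ.+ c ℕ.+ (m ℕ.+ w) ≡ m ℕ.+ (m ℕ.+ (c ℕ.+ w))
  rearrange = solve-∀

-- Evenness after a further `toggle` is included because it tells merged images apart from toggled
-- ones.
merge-even : Mergeable π → IsOverpartition n π → Even (merge π) × Even (toggle (merge π))
merge-even (mergeable {ρ = ρ} {m = m} {b = b} {c = c} pl ev)
  (isOverpartition (_ ∷ _ ∷ c>0 ∷ _) (_ ∷ dec) _ _) = go b
  where
  bound : All (λ p → size p ℕ.≤ m) (part m false ∷ ρ)
  bound with _ ∷ le ← bounded {ρ = part c false ∷ ρ} dec = ℕ.≤-refl ∷ le
  m<m+c : m ℕ.< m ℕ.+ c
  m<m+c = ℕ.m<m+n m c>0
  even-false : Even (part (m ℕ.+ c) false ∷ part m false ∷ ρ)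
  even-false = trans (cong parity (ℓ-plain (refl ∷ refl ∷ pl))) ev
  -- As `c` is positive, the overlined part exceeds all others and `ℓN≥O` is 0.
  even-true : Even (part (m ℕ.+ c) true ∷ part m false ∷ ρ)
  even-true = cong parity (trans (ℓ-overlined-head {m = m ℕ.+ c} (refl ∷ pl))
    (cong length (filter-none (λ p → m ℕ.+ c ℕ.≤? size p)
      (All.map (λ p≤m m+c≤p → ℕ.<⇒≱ m<m+c (ℕ.≤-trans m+c≤p p≤m)) bound))))
  go : ∀ b → Even (part (m ℕ.+ c) b ∷ part m false ∷ ρ) × Even (part (m ℕ.+ c) (not b) ∷ part m false ∷ ρ)
  go true  = even-true , even-false
  go false = even-false , even-true

-- The injection from odd to even overpartitions

odd-even-absurd : ∀ π → Odd π → Even π → A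
odd-even-absurd π o e with () ← trans (sym o) e

evenize : List Part → List Part
evenize π with parity (ℓN≥O (toggle π))
... | 0ℙ = toggle π
... | 1ℙ = merge π

-- A view of `evenize`, indexed by its value: matching on it reveals the value together with the
-- reason for the branch.
data Evenized (n : ℕ) (π : List Part) : List Part → Set where
  toggled : Even (toggle π) → Evenized n π (toggle π)
  merged  : Odd (toggle π) → Mergeable π → Evenized n π (merge π)

module _ (n>0 : 0 ℕ.< n) where

  evenized : IsOverpartition n π → Odd π → Evenized n π (evenize π)
  evenized {π} h o with parity (ℓN≥O (toggle π)) in eq
  ... | 0ℙ = toggled eq
  ... | 1ℙ = merged eq (mergeable-of-odd h n>0 o eq)

  evenize-even : IsOverpartition n π → Odd π → IsOverpartition n (evenize π) × Even (evenize π)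
  evenize-even {π} h o with evenize π | evenized h o
  ... | _ | toggled e = toggle-overpartition h , e
  ... | _ | merged _ r = merge-overpartition r h , proj₁ (merge-even r h)

  evenize-injective : ∀ {π π′} → IsOverpartition n π → Odd π → IsOverpartition n π′ → Odd π′ →
    evenize π ≡ evenize π′ → π ≡ π′
  evenize-injective {π} {π′} h o h′ o′ eq
    with evenize π | evenized h o | evenize π′ | evenized h′ o′
  ... | _ | toggled _ | _ | toggled _ = toggle-injective eq
  ... | _ | merged _ r | _ | merged _ r′ = merge-injective r r′ eq
  -- In the mixed cases, toggling the common value once more gives an odd overpartition on one side
  -- and an even one on the other.
  ... | _ | toggled _ | _ | merged _ r′ = odd-even-absurd π o
    (subst Even (trans (cong toggle (sym eq)) (toggle-involutive π)) (proj₂ (merge-even r′ h′)))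
  ... | _ | merged _ r | _ | toggled _ = odd-even-absurd π′ o′
    (subst Even (trans (cong toggle eq) (toggle-involutive π′)) (proj₂ (merge-even r h)))

-- An even overpartition outside the image

module _ (k : ℕ) where

  missed : List Part
  missed = part (2 ℕ.+ k) false ∷ part 1 false ∷ []

  missed-overpartition : IsOverpartition (3 ℕ.+ k) missed
  missed-overpartition = isOverpartition (z<s ∷ z<s ∷ []) (s≤s z≤n ∷ [-])
    (((λ ()) ∷ []) ∷ [] ∷ []) (cong (2 ℕ.+_) (ℕ.+-comm k 1))

  evenize≢missed : IsOverpartition (3 ℕ.+ k) π → Odd π → evenize π ≢ missed
  evenize≢missed {π} h o eq with evenize π | evenized z<s h o
  -- Here `π` would be `missed` with 2 + k overlined; the part 1 is smaller than that, so `ℓN≥O π`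
  -- is 0.
  ... | _ | toggled _
    with refl ← trans (sym (toggle-involutive π)) (cong toggle eq) with () ← o
  -- Here `π` would consist of 1, 1, 1 + k. The ordering forces k = 0, and toggling 1, 1, 1 gives
  -- the even value 2.
  evenize≢missed h o eq | _ | merged o′ r
    with refl ← trans (sym (unmerge-merge r)) (cong unmerge eq)
    with isOverpartition _ (_ ∷ s≤s z≤n ∷ _) _ _ ← h
    with () ← o′

-- Comparison of the odd and even counts

∈-overpartitions⁻ : π ∈ overpartitions n → IsOverpartition n π
∈-overpartitions⁻ = Equivalence.to (∈-overpartitions _ _)

∈-overpartitions⁺ : IsOverpartition n π → π ∈ overpartitions n
∈-overpartitions⁺ = Equivalence.from (∈-overpartitions _ _)

even? : Decidable Even
even? π = parity (ℓN≥O π) Parity.≟ 0ℙ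

odd? : Decidable Odd
odd? π = parity (ℓN≥O π) Parity.≟ 1ℙ

module _ (n : ℕ) {P : List Part → Set} (P? : Decidable P) where

  ∈-filter-overpartitions⁻ : π ∈ filter P? (overpartitions n) → IsOverpartition n π × P π
  ∈-filter-overpartitions⁻ π∈ with m , p ← ∈-filter⁻ P? {xs = overpartitions n} π∈ = ∈-overpartitions⁻ m , p

  ∈-filter-overpartitions⁺ : IsOverpartition n π × P π → π ∈ filter P? (overpartitions n)
  ∈-filter-overpartitions⁺ (h , p) = ∈-filter⁺ P? (∈-overpartitions⁺ h) p

  filter-overpartitions-unique : Unique (filter P? (overpartitions n))
  filter-overpartitions-unique = Unique.filter⁺ P? (overpartitions-unique n)

module _ {n : ℕ} (n>0 : 0 ℕ.< n) where

  evenize-∈ : ∀ {π} → π ∈ filter odd? (overpartitions n) → evenize π ∈ filter even? (overpartitions n)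
  evenize-∈ π∈ with h , o ← ∈-filter-overpartitions⁻ n odd? π∈ =
    ∈-filter-overpartitions⁺ n even? (evenize-even n>0 h o)

  evenize-injectiveOn : InjectiveOn (filter odd? (overpartitions n)) evenize
  evenize-injectiveOn π∈ π′∈
    with h , o ← ∈-filter-overpartitions⁻ n odd? π∈ | h′ , o′ ← ∈-filter-overpartitions⁻ n odd? π′∈ =
    evenize-injective n>0 h o h′ o′

  B≤A : BN≥O n ℕ.≤ AN≥O n
  B≤A = injection⇒length≤ (filter-overpartitions-unique n odd?) evenize-∈ evenize-injectiveOn

B<A : 3 ℕ.≤ n → BN≥O n ℕ.< AN≥O n
B<A {n@(suc (suc (suc k)))} (s≤s (s≤s (s≤s z≤n))) =
  nonsurjective⇒length< (filter-overpartitions-unique n odd?) (evenize-∈ {n} z<s) (evenize-injectiveOn {n} z<s)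
    (∈-filter-overpartitions⁺ n even? (missed-overpartition k , refl))
    λ π∈ → let h , o = ∈-filter-overpartitions⁻ n odd? π∈ in evenize≢missed k h o

-- Evenness of the total number of overpartitions

headOverlined : List Part → Bool
headOverlined []      = false
headOverlined (p ∷ _) = overlined p

HeadOverlined : Bool → List Part → Set
HeadOverlined b π = headOverlined π ≡ b

headOverlined? : ∀ b → Decidable (HeadOverlined b)
headOverlined? b π = headOverlined π Bool.≟ b

module _ {n : ℕ} (n>0 : 0 ℕ.< n) where

  toggle-head : IsOverpartition n π → HeadOverlined b π → HeadOverlined (not b) (toggle π)
  toggle-head {π = []}    h _    = contradiction (IsOverpartition.weight≡n h) (ℕ.<⇒≢ n>0)
  toggle-head {π = _ ∷ _} _ refl = refl

  -- One inequality for both values of `b` suffices: its two instances are converse and give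
  -- equality.
  count-head≤ : ∀ b → length (filter (headOverlined? b) (overpartitions n))
                  ℕ.≤ length (filter (headOverlined? (not b)) (overpartitions n))
  count-head≤ b = injection⇒length≤ (filter-overpartitions-unique n (headOverlined? b))
    (λ π∈ → let h , hd = ∈-filter-overpartitions⁻ n (headOverlined? b) π∈ in
      ∈-filter-overpartitions⁺ n (headOverlined? (not b)) (toggle-overpartition h , toggle-head h hd))
    (λ _ _ → toggle-injective)

  -- All overpartitions are counted twice over, split once by the parity of `ℓN≥O` and once by the
  -- first overline; the second split has equal halves.
  2∣A+B : 2 ℕ∣.∣ AN≥O n ℕ.+ BN≥O n
  2∣A+B = ℕ∣.divides (count true) (begin
    AN≥O n ℕ.+ BN≥O n           ≡⟨ length-filter-complement even? odd? parities (overpartitions n) ⟩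
    length (overpartitions n)   ≡⟨ length-filter-complement (headOverlined? true) (headOverlined? false) heads (overpartitions n) ⟨
    count true ℕ.+ count false  ≡⟨ cong (count true ℕ.+_) (ℕ.≤-antisym (count-head≤ false) (count-head≤ true)) ⟩
    count true ℕ.+ count true   ≡⟨ double (count true) ⟩
    count true ℕ.* 2            ∎)
    where
    open ≡-Reasoning
    count : Bool → ℕ
    count b = length (filter (headOverlined? b) (overpartitions n))
    parities : ∀ π → does (odd? π) ≡ not (does (even? π))
    parities π with parity (ℓN≥O π)
    ... | 0ℙ = refl
    ... | 1ℙ = refl
    heads : ∀ π → does (headOverlined? false π) ≡ not (does (headOverlined? true π))
    heads π with headOverlined π
    ... | false = refl
    ... | true  = refl
    double : ∀ x → x ℕ.+ x ≡ x ℕ.* 2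
    double = solve-∀

-- Passage to the integer difference

2∣m+n⇒2∣m∸n : n ℕ.≤ m → 2 ℕ∣.∣ m ℕ.+ n → 2 ℕ∣.∣ m ℕ.∸ n
2∣m+n⇒2∣m∸n {n} {m} n≤m 2∣ = ℕ∣.∣m+n∣m⇒∣n (subst (2 ℕ∣.∣_) eq 2∣) (ℕ∣.m∣m*n n)
  where
  rearrange : ∀ d n → d ℕ.+ n ℕ.+ n ≡ 2 ℕ.* n ℕ.+ d
  rearrange = solve-∀
  eq : m ℕ.+ n ≡ 2 ℕ.* n ℕ.+ (m ℕ.∸ n)
  eq = trans (cong (ℕ._+ n) (sym (ℕ.m∸n+n≡m n≤m))) (rearrange (m ℕ.∸ n) n)

theorem2p5 : (n : ℕ) → n ℕ.≥ 1 →
    ((+ 2) ∣ (+ AN≥O n - + BN≥O n)) ×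
    ((+ 0) ≤ (+ AN≥O n - + BN≥O n)) ×
    (n ℕ.≥ 3 → (+ 0) < (+ AN≥O n - + BN≥O n))
theorem2p5 n n≥1 =
  -- Integer divisibility is divisibility of absolute values, so `diff` is used under `ℤ.∣_∣`.
  subst (2 ℕ∣.∣_) (cong ℤ.∣_∣ (sym diff)) (2∣m+n⇒2∣m∸n (B≤A n≥1) (2∣A+B n≥1)) ,
  subst ((+ 0) ≤_) (sym diff) (ℤ.+≤+ z≤n) ,
  λ n≥3 → subst ((+ 0) <_) (sym diff) (ℤ.+<+ (ℕ.m<n⇒0<n∸m (B<A n≥3)))
  where
  diff : + AN≥O n - + BN≥O n ≡ + (AN≥O n ℕ.∸ BN≥O n)
  diff = trans (ℤ.m-n≡m⊖n (AN≥O n) (BN≥O n)) (ℤ.⊖-≥ (B≤A n≥1))
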